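{- For every integer $k\ge 0$ and every graph $G$ of treewidth at most $k$, we have $\pi^*(G)\le 4^k$.
   Context: All graphs are finite and simple. A lazy walk in a graph $G$ is a sequence of vertices $v_1,\dots,v_m$ such that for each $i<m$, either $v_iv_{i+1}\in E(G)$ or $v_i=v_{i+1}$. For a colouring $\phi$ of $V(G)$, a lazy walk $v_1,\dots,v_{2t}$ is $\phi$-repetitive if $\phi(v_i)=\phi(v_{i+t})$ for each $i\in\{1,\dots,t\}$. A colouring $\phi$ is strongly nonrepetitive if for every $\phi$-repetitive lazy walk $v_1,\dots,v_{2t}$ there exists $i\in\{1,\dots,t\}$ with $v_i=v_{i+t}$. $\pi^*(G)$ denotes the minimum number of colours in a strongly nonrepetitive colouring of $G$. -}

module Defs where

open import Data.Empty using (⊥-elim)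
open import Data.Fin using (Fin; zero; suc; toℕ; fromℕ; splitAt; _↑ˡ_; _↑ʳ_; finToFun; funToFin)
open import Data.Fin.Properties
  using (_≟_; any?; toℕ-↑ˡ; toℕ-↑ʳ; toℕ-fromℕ; toℕ-injective; toℕ<n;
         splitAt⁻¹-↑ˡ; splitAt⁻¹-↑ʳ; splitAt-↑ˡ; splitAt-↑ʳ; finToFun-funToFin)
open import Data.Fin.Subset using (Subset; _∈_; ∣_∣)
open import Data.List using (List; []; _∷_; allFin; cartesianProduct)
open import Data.List.Membership.Propositional using () renaming (_∈_ to _∈ˡ_)
open import Data.List.Membership.Propositional.Properties using (∈-cartesianProduct⁺; ∈-allFin)
open import Data.List.Relation.Unary.Any using (here; there)
open import Data.Nat using (ℕ; zero; suc; _+_; _≤_; z≤n; s≤s; NonZero)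
open import Data.Nat.Properties
  using (+-suc; +-identityʳ; +-cancelˡ-≡; suc-injective; 1+n≰n; n≤1+n; m≤m+n; ≤∧≢⇒<;
         ≤-trans; ≤-antisym; ≤-pred; ≤-reflexive)
open import Data.Product using (Σ; ∃; _×_; _,_; proj₁; proj₂)
open import Data.Product.Properties using () renaming (≡-dec to ×-≡-dec)
open import Data.Sum using (_⊎_; inj₁; inj₂; [_,_]′)
open import Data.Unit using (⊤)
open import Data.Vec.Functional using (Vector; _++_) renaming (_∷_ to _∷ᵛ_)
open import Function.Base using (id; _∘_)
open import Function.Definitions using (Injective)
open import Level using (0ℓ)
open import Relation.Binary using (Rel; Decidable; Irreflexive; Symmetric; DecidableEquality)
open import Relation.Binary.Construct.Closure.ReflexiveTransitive using (Star; ε; _◅_; _◅◅_)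
open import Relation.Binary.PropositionalEquality
  using (_≡_; refl; sym; trans; cong; subst₂; _≗_)
open import Relation.Nullary using (¬_; Dec; yes; no)
open import Relation.Nullary.Decidable using (_×-dec_; _⊎-dec_; ¬?; map′)

------------------------------------------------------------------------
-- Graphs

-- Up to isomorphism, the vertex set of a finite graph is Fin order.  Adjacency
-- is decidable, as it is classically; constructively this must be required.
record SimpleGraph : Set₁ where
  infix 4 _~_ _~?_
  field
    order    : ℕ
    _~_      : Rel (Fin order) 0ℓ
    _~?_     : Decidable _~_
    ~-irrefl : Irreflexive _≡_ _~_
    ~-sym    : Symmetric _~_

  Vertex : Set
  Vertex = Fin order

open SimpleGraph using (order; Vertex)

-- A sequence v₁, …, vₘ in which consecutive terms are related by R.
IsWalk : {A : Set} → Rel A 0ℓ → {m : ℕ} → Vector A m → Set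
IsWalk R v = ∀ i j → suc (toℕ i) ≡ toℕ j → R (v i) (v j)

module _ (G : SimpleGraph) where
  open SimpleGraph G using (_~_)

  -- The subgraph induced by the vertices satisfying P is connected.
  -- (It may be empty; nonemptiness is required separately where needed.)
  InducesConnected : (Vertex G → Set) → Set
  InducesConnected P =
    ∀ {x y} → P x → P y → Star (λ u v → P u × P v × u ~ v) x y

  record Cycle : Set where
    field
      {extra}  : ℕ
      vertices : Vector (Vertex G) (3 + extra)
      distinct : Injective _≡_ _≡_ vertices
      walk     : IsWalk _~_ vertices
      closing  : vertices (fromℕ (2 + extra)) ~ vertices zero

  record IsTree : Set where
    field
      nonempty  : Vertex G
      connected : InducesConnected (λ _ → ⊤)
      acyclic   : ¬ Cycle

------------------------------------------------------------------------
-- Treewidth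

record TreeDecomposition (G : SimpleGraph) : Set₁ where
  open SimpleGraph G using (_~_)
  field
    tree          : SimpleGraph
    isTree        : IsTree tree
    bag           : Vertex tree → Subset (order G)
    vertexCovered : ∀ v → ∃ λ x → v ∈ bag x
    edgeCovered   : ∀ {u v} → u ~ v → ∃ λ x → u ∈ bag x × v ∈ bag x
    bagsConnected : ∀ v → InducesConnected tree (λ x → v ∈ bag x)

-- The width of a tree decomposition is the maximum of ∣ bag x ∣ - 1, so width
-- at most k means that every bag has at most k + 1 elements.
WidthAtMost : {G : SimpleGraph} → ℕ → TreeDecomposition G → Set
WidthAtMost k D = ∀ x → ∣ TreeDecomposition.bag D x ∣ ≤ suc k

-- Treewidth is the minimum width of a tree decomposition.
TreewidthAtMost : ℕ → SimpleGraph → Set₁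
TreewidthAtMost k G = Σ (TreeDecomposition G) (WidthAtMost k)

------------------------------------------------------------------------
-- Strongly nonrepetitive colourings

module _ (G : SimpleGraph) where
  open SimpleGraph G using (_~_)

  LazyStep : Rel (Vertex G) 0ℓ
  LazyStep u v = u ~ v ⊎ u ≡ v

  IsLazyWalk : {m : ℕ} → Vector (Vertex G) m → Set
  IsLazyWalk = IsWalk LazyStep

-- In a sequence of length t + t, the term with index i ↑ˡ t is in position i
-- and the term with index t ↑ʳ i is in position i + t.
Repetitive : {V C : Set} → (V → C) → (t : ℕ) → Vector V (t + t) → Set
Repetitive φ t v = ∀ i → φ (v (i ↑ˡ t)) ≡ φ (v (t ↑ʳ i))

-- t = 0 is excluded: the empty walk would be repetitive for every colouring,
-- with no i to witness the conclusion.
StronglyNonrepetitive : (G : SimpleGraph) {C : Set} → (Vertex G → C) → Set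
StronglyNonrepetitive G φ =
  ∀ t → .{{_ : NonZero t}} → (v : Vector (Vertex G) (t + t)) →
  IsLazyWalk G v → Repetitive φ t v → ∃ λ i → v (i ↑ˡ t) ≡ v (t ↑ʳ i)

StronglyNonrepetitivelyColourable : SimpleGraph → ℕ → Set
StronglyNonrepetitivelyColourable G c =
  Σ (Vertex G → Fin c) (StronglyNonrepetitive G)

IsMinimum : (ℕ → Set) → ℕ → Set
IsMinimum P m = P m × (∀ n → P n → m ≤ n)

------------------------------------------------------------------------
-- Existence of the minimum number of colours.  Constructively this requires
-- strong nonrepetitiveness to be decidable; φ fails to be strongly
-- nonrepetitive exactly when, in the graph of pairs (vᵢ , vᵢ₊ₜ) of distinct
-- vertices with equal colours, some (a , b) reaches some (x , y) with
-- x = b or x adjacent to b.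

private

  leastBelow : {P : ℕ → Set} → (∀ n → Dec (P n)) → ∀ b →
               ∃ (IsMinimum P) ⊎ (∀ n → P n → b ≤ n)
  leastBelow P? zero = inj₂ λ _ _ → z≤n
  leastBelow P? (suc b) with leastBelow P? b
  ... | inj₁ m = inj₁ m
  ... | inj₂ b≤ with P? b
  ...   | yes pb = inj₁ (b , pb , b≤)
  ...   | no ¬pb = inj₂ λ n pn → ≤∧≢⇒< (b≤ n pn) λ { refl → ¬pb pn }

  minimum : {P : ℕ → Set} → (∀ n → Dec (P n)) → ∀ {b} → P b → ∃ (IsMinimum P)
  minimum P? {b} pb with leastBelow P? (suc b)
  ... | inj₁ m  = m
  ... | inj₂ b< = ⊥-elim (1+n≰n (b< b pb))

  module Reachability {A : Set} (_≟ᴬ_ : DecidableEquality A)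
                      {R : Rel A 0ℓ} (R? : Decidable R) where

    -- Reachability through intermediate points taken from a list.
    Via : List A → Rel A 0ℓ
    Via []       a b = a ≡ b ⊎ R a b
    Via (x ∷ xs) a b = Via xs a b ⊎ Via xs a x × Via xs x b

    via? : ∀ xs → Decidable (Via xs)
    via? []       a b = (a ≟ᴬ b) ⊎-dec R? a b
    via? (x ∷ xs) a b = via? xs a b ⊎-dec (via? xs a x ×-dec via? xs x b)

    base : ∀ xs {a b} → a ≡ b ⊎ R a b → Via xs a b
    base []       r = r
    base (x ∷ xs) r = inj₁ (base xs r)

    compose : ∀ {xs w a b} → w ∈ˡ xs → Via xs a w → Via xs w b → Via xs a b
    compose (here refl) p q = inj₂ ([ id , proj₁ ]′ p , [ id , proj₂ ]′ q)
    compose (there w∈) (inj₁ p)        (inj₁ q)        = inj₁ (compose w∈ p q)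
    compose (there w∈) (inj₁ p)        (inj₂ (q , q′)) = inj₂ (compose w∈ p q , q′)
    compose (there w∈) (inj₂ (p , p′)) (inj₁ q)        = inj₂ (p , compose w∈ p′ q)
    compose (there w∈) (inj₂ (p , _))  (inj₂ (_ , q))  = inj₂ (p , q)

    sound : ∀ xs {a b} → Via xs a b → Star R a b
    sound []       (inj₁ refl)    = ε
    sound []       (inj₂ r)       = r ◅ ε
    sound (x ∷ xs) (inj₁ p)       = sound xs p
    sound (x ∷ xs) (inj₂ (p , q)) = sound xs p ◅◅ sound xs q

    star? : (xs : List A) → (∀ a → a ∈ˡ xs) → Decidable (Star R)
    star? xs all a b = map′ (sound xs) complete (via? xs a b)
      where
      complete : ∀ {a b} → Star R a b → Via xs a b
      complete ε       = base xs (inj₁ refl)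
      complete (r ◅ p) = compose (all _) (base xs (inj₂ r)) (complete p)

  walk⇒star : {A : Set} {R : Rel A 0ℓ} → ∀ m (f : Vector A (suc m)) →
              IsWalk R f → Star R (f zero) (f (fromℕ m))
  walk⇒star zero    f w = ε
  walk⇒star (suc m) f w =
    w zero (suc zero) refl ◅ walk⇒star m (f ∘ suc) λ i j e → w (suc i) (suc j) (cong suc e)

  record WalkBetween {A : Set} (R : Rel A 0ℓ) (a b : A) : Set where
    constructor mkWalk
    field
      len   : ℕ
      seq   : Vector A (suc len)
      walk  : IsWalk R seq
      start : seq zero ≡ a
      end   : seq (fromℕ len) ≡ b

  star⇒walk : {A : Set} {R : Rel A 0ℓ} {a b : A} → Star R a b → WalkBetween R a b
  star⇒walk {a = a} ε = mkWalk 0 (λ _ → a) (λ { zero zero () }) refl refl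
  star⇒walk {R = R} {a = a} (r ◅ p) with star⇒walk p
  ... | mkWalk m f w refl refl = mkWalk (suc m) (a ∷ᵛ f) w′ refl refl
    where
    w′ : IsWalk R (a ∷ᵛ f)
    w′ zero    (suc zero) e = r
    w′ (suc i) (suc j)    e = w i j (suc-injective e)

  ++-walk : {A : Set} {R : Rel A 0ℓ} {m n : ℕ}
            (f : Vector A (suc m)) (g : Vector A (suc n)) →
            IsWalk R f → IsWalk R g → R (f (fromℕ m)) (g zero) → IsWalk R (f ++ g)
  ++-walk {R = R} {m} {n} f g wf wg r i j e
    with splitAt (suc m) i in eᵢ | splitAt (suc m) j in eⱼ
  ... | inj₁ i′ | inj₁ j′ = wf i′ j′
        (trans (cong suc (sym (toℕ-↑ˡ i′ (suc n))))
        (trans (cong (suc ∘ toℕ) (splitAt⁻¹-↑ˡ eᵢ))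
        (trans e (trans (cong toℕ (sym (splitAt⁻¹-↑ˡ eⱼ))) (toℕ-↑ˡ j′ (suc n))))))
  ... | inj₂ i′ | inj₂ j′ = wg i′ j′
        (+-cancelˡ-≡ (suc m) _ _
        (trans (+-suc (suc m) (toℕ i′))
        (trans (cong suc (sym (toℕ-↑ʳ (suc m) i′)))
        (trans (cong (suc ∘ toℕ) (splitAt⁻¹-↑ʳ eᵢ))
        (trans e (trans (cong toℕ (sym (splitAt⁻¹-↑ʳ eⱼ))) (toℕ-↑ʳ (suc m) j′)))))))
  ... | inj₁ i′ | inj₂ j′ = subst₂ R (cong f (sym i′≡)) (cong g (sym j′≡)) r
    where
    eq : suc (toℕ i′) ≡ suc m + toℕ j′
    eq = trans (cong suc (sym (toℕ-↑ˡ i′ (suc n))))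
         (trans (cong (suc ∘ toℕ) (splitAt⁻¹-↑ˡ eᵢ))
         (trans e (trans (cong toℕ (sym (splitAt⁻¹-↑ʳ eⱼ))) (toℕ-↑ʳ (suc m) j′))))
    m≡ : m + toℕ j′ ≡ m
    m≡ = ≤-antisym (≤-trans (≤-reflexive (sym (suc-injective eq))) (≤-pred (toℕ<n i′)))
                   (m≤m+n m _)
    i′≡ : i′ ≡ fromℕ m
    i′≡ = toℕ-injective (trans (suc-injective eq) (trans m≡ (sym (toℕ-fromℕ m))))
    j′≡ : j′ ≡ zero
    j′≡ = toℕ-injective (+-cancelˡ-≡ m _ _ (trans m≡ (sym (+-identityʳ m))))
  ... | inj₂ i′ | inj₁ j′ = ⊥-elim (1+n≰n (≤-trans (s≤s (≤-trans (m≤m+n (suc m) (toℕ i′))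
        (≤-trans (≤-reflexive (trans (sym (toℕ-↑ʳ (suc m) i′)) (cong toℕ (splitAt⁻¹-↑ʳ eᵢ))))
        (≤-trans (n≤1+n _) (≤-reflexive e)))))
        (≤-trans (s≤s (≤-reflexive (trans (cong toℕ (sym (splitAt⁻¹-↑ˡ eⱼ))) (toℕ-↑ˡ j′ (suc n)))))
                 (toℕ<n j′))))

  module Decide (G : SimpleGraph) {c : ℕ} (φ : Vertex G → Fin c) where
    open SimpleGraph G using (_~?_)

    Pair : Set
    Pair = Vertex G × Vertex G

    Bad : Pair → Set
    Bad (a , b) = ¬ (a ≡ b) × φ a ≡ φ b

    Step : Rel Pair 0ℓ
    Step (a , b) (a′ , b′) = LazyStep G a a′ × LazyStep G b b′ × Bad (a′ , b′)

    lazy? : Decidable (LazyStep G)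
    lazy? u v = (u ~? v) ⊎-dec (u ≟ v)

    bad? : ∀ p → Dec (Bad p)
    bad? (a , b) = ¬? (a ≟ b) ×-dec (φ a ≟ φ b)

    star? : Decidable (Star Step)
    star? = Reachability.star? ≡-dec
      (λ (a , b) (a′ , b′) → lazy? a a′ ×-dec (lazy? b b′ ×-dec bad? (a′ , b′)))
      (cartesianProduct (allFin _) (allFin _))
      (λ (a , b) → ∈-cartesianProduct⁺ (∈-allFin a) (∈-allFin b))
      where
      ≡-dec : DecidableEquality Pair
      ≡-dec = ×-≡-dec _≟_ _≟_

    Violation : Set
    Violation = ∃ λ a → ∃ λ b → ∃ λ x → ∃ λ y →
      Bad (a , b) × Star Step (a , b) (x , y) × LazyStep G x b

    violation? : Dec Violation
    violation? = any? λ a → any? λ b → any? λ x → any? λ y →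
      bad? (a , b) ×-dec (star? (a , b) (x , y) ×-dec lazy? x b)

    allBad : ∀ m (f : Vector Pair (suc m)) → IsWalk Step f → Bad (f zero) → ∀ i → Bad (f i)
    allBad m       f w bad zero    = bad
    allBad (suc m) f w bad (suc i) =
      allBad m (f ∘ suc) (λ i j e → w (suc i) (suc j) (cong suc e))
             (proj₂ (proj₂ (w zero (suc zero) refl))) i

    violation⇒¬ : Violation → ¬ StronglyNonrepetitive G φ
    violation⇒¬ (a , b , x , y , bad , p , l) sn with star⇒walk p
    ... | mkWalk m f w refl refl with sn (suc m) v v-walk v-rep
      where
      f₁ f₂ : Vector (Vertex G) (suc m)
      f₁ = proj₁ ∘ f
      f₂ = proj₂ ∘ f
      v : Vector (Vertex G) (suc m + suc m)
      v = f₁ ++ f₂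
      v-walk : IsLazyWalk G v
      v-walk = ++-walk {R = LazyStep G} f₁ f₂ (λ i j e → proj₁ (w i j e)) (λ i j e → proj₁ (proj₂ (w i j e))) l
      v-rep : Repetitive φ (suc m) v
      v-rep i rewrite splitAt-↑ˡ (suc m) i (suc m) | splitAt-↑ʳ (suc m) (suc m) i
        = proj₂ (allBad m f w bad i)
    ... | i , eq rewrite splitAt-↑ˡ (suc m) i (suc m) | splitAt-↑ʳ (suc m) (suc m) i
        = proj₁ (allBad m f w bad i) eq

    ¬violation⇒ : ¬ Violation → StronglyNonrepetitive G φ
    ¬violation⇒ ¬viol (suc s) v w rep
      with any? (λ i → v (i ↑ˡ suc s) ≟ v (suc s ↑ʳ i))
    ... | yes found = found
    ... | no  none  = ⊥-elim (¬viol (_ , _ , _ , _ , bad zero , walk⇒star s f f-walk , joint))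
      where
      f : Vector Pair (suc s)
      f i = v (i ↑ˡ suc s) , v (suc s ↑ʳ i)
      bad : ∀ i → Bad (f i)
      bad i = (λ eq → none (i , eq)) , rep i
      f-walk : IsWalk Step f
      f-walk i j e =
          w _ _ (trans (cong suc (toℕ-↑ˡ i (suc s))) (trans e (sym (toℕ-↑ˡ j (suc s)))))
        , w _ _ (trans (cong suc (toℕ-↑ʳ (suc s) i))
                (trans (sym (+-suc (suc s) (toℕ i)))
                (trans (cong (suc s +_) e) (sym (toℕ-↑ʳ (suc s) j)))))
        , bad j
      joint : LazyStep G (v (fromℕ s ↑ˡ suc s)) (v (suc s ↑ʳ zero))
      joint = w _ _ (trans (cong suc (trans (toℕ-↑ˡ (fromℕ s) (suc s)) (toℕ-fromℕ s)))
                    (sym (trans (toℕ-↑ʳ (suc s) (zero {s})) (+-identityʳ (suc s)))))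

    stronglyNonrepetitive? : Dec (StronglyNonrepetitive G φ)
    stronglyNonrepetitive? with violation?
    ... | yes viol = no (violation⇒¬ viol)
    ... | no ¬viol = yes (¬violation⇒ ¬viol)

  respects-≗ : ∀ G {C : Set} {φ ψ : Vertex G → C} → φ ≗ ψ →
               StronglyNonrepetitive G φ → StronglyNonrepetitive G ψ
  respects-≗ G φ≗ψ sn t v w rep =
    sn t v w λ i → trans (φ≗ψ _) (trans (rep i) (sym (φ≗ψ _)))

  colourable? : ∀ G c → Dec (StronglyNonrepetitivelyColourable G c)
  colourable? G c = map′
    (λ (k , sn) → finToFun k , sn)
    (λ (φ , sn) → funToFin φ , respects-≗ G (sym ∘ finToFun-funToFin φ) sn)
    (any? λ k → Decide.stronglyNonrepetitive? G (finToFun k))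

  id-stronglyNonrepetitive : ∀ G → StronglyNonrepetitive G id
  id-stronglyNonrepetitive G (suc t) v w rep = zero , rep zero

π*-exists : ∀ G → ∃ (IsMinimum (StronglyNonrepetitivelyColourable G))
π*-exists G = minimum (colourable? G) (id , id-stronglyNonrepetitive G)

π* : SimpleGraph → ℕ
π* G = proj₁ (π*-exists G)

π*-isMinimum : ∀ G → IsMinimum (StronglyNonrepetitivelyColourable G) (π* G)
π*-isMinimum G = proj₂ (π*-exists G)

{-# OPTIONS --safe #-}

-- Removing leaves of the decomposition tree one by one orders its nodes, and
-- hence the vertices, so that in the graph joining the vertices that share a
-- bag the earlier neighbours of a vertex form a clique of size at most k.
-- Layer this chordal graph by the distance to the vertices without earlier
-- neighbours: within a layer a vertex has at most k - 1 earlier neighbours, and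
-- the neighbours in a layer of a connected set of higher vertices form a
-- clique.  Colour a vertex by its inductive colour in its layer and the letter
-- of its layer in a squarefree word on four letters in which any three
-- consecutive letters are distinct.  Then vᵢ and vᵢ₊ₜ have the same level in
-- every repetitive lazy walk; deleting from the walk all vertices outside its
-- lowest layer leaves a repetitive lazy walk of that layer.

module Submission where

open import Defs
open import Data.Bool using (Bool; true; false; not; if_then_else_)
open import Data.Bool.Properties using (not-¬; not-involutive)
open import Data.Empty using (⊥; ⊥-elim)
open import Data.Fin using (Fin; zero; suc; toℕ; fromℕ; inject≤; combine; _↑ˡ_; _↑ʳ_)
open import Data.Fin.Patterns using (0F; 1F; 2F; 3F)
open import Data.Fin.Properties
  using (_≟_; any?; toℕ-injective; toℕ-fromℕ; toℕ-inject≤; inject≤-injective; injective⇒≤; toℕ<n;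
         toℕ-↑ˡ; toℕ-↑ʳ; combine-injectiveˡ; combine-injectiveʳ)
open import Data.Fin.Subset using (Subset; _∈_; ∣_∣; _-_; ⊤)
open import Data.Fin.Subset.Properties
  using (_∈?_; nonempty?; x∈p⇒∣p-x∣<∣p∣; x∈p∧x≢y⇒x∈p-y; ∈⊤; ∣⊤∣≡n)
open import Data.List using (List; []; _∷_; length; map; filter; allFin)
open import Data.List.Extrema.Nat
  using (argmin; argmin-all; argmin-sel; f[argmin]≤f[xs]; min; min≤⊤; min≤xs)
open import Data.List.Membership.Propositional using (lose) renaming (_∈_ to _∈ˡ_)
open import Data.List.Membership.Propositional.Properties
  using (∈-map⁺; ∈-map⁻; ∈-filter⁺; ∈-filter⁻; ∈-allFin)
open import Data.List.Properties using (filter-notAll; map-cong-local)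
open import Data.List.Relation.Unary.All as All using (All; []; _∷_)
open import Data.List.Relation.Unary.All.Properties using (all-filter)
open import Data.List.Relation.Unary.AllPairs using ([]; _∷_)
open import Data.List.Relation.Unary.Any using (here; there)
open import Data.List.Relation.Unary.Unique.Propositional using (Unique)
open import Data.List.Relation.Unary.Unique.Propositional.Properties using (allFin⁺; filter⁺)
open import Data.Nat renaming (_≟_ to _≟ℕ_)
open import Data.Nat.DivMod using (m≡m%n+[m/n]*n; m%n<n)
open import Data.Nat.Induction using (<-wellFounded)
open import Data.Nat.Properties hiding (_≟_)
open import Data.Nat.Tactic.RingSolver using (solve-∀)
open import Data.Product using (∃; ∃₂; _×_; _,_; proj₁; proj₂)
open import Data.Sum using (_⊎_; inj₁; inj₂; swap)
open import Data.Vec.Functional using (Vector) renaming (_∷_ to _∷ᵛ_)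
open import Function using (id; _∘_)
open import Function.Definitions using (Injective)
open import Induction.WellFounded using (Acc; acc)
open import Relation.Binary using (Rel; tri<; tri≈; tri>)
open import Relation.Binary.Construct.Closure.ReflexiveTransitive
  using (Star; ε; _◅_; _◅◅_; gmap; reverse)
open import Relation.Binary.PropositionalEquality
open import Relation.Nullary using (¬_; contradiction; yes; no)
open import Relation.Nullary.Decidable using (_×-dec_; ¬?; decidable-stable)

open SimpleGraph using (order; Vertex)

-- A word on four letters

Square : {A : Set} → (ℕ → A) → ℕ → ℕ → Set
Square s D p = ∀ j → j < D → s (p + j) ≡ s (p + j + D)

odd : ℕ → Bool
odd zero    = false
odd (suc n) = not (odd n)

odd-+ : ∀ m n → odd m ≡ true → odd (m + n) ≡ not (odd n)
odd-+ (suc zero)    n _ = refl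
odd-+ (suc (suc m)) n e = trans (not-involutive (odd (m + n)))
  (odd-+ m n (trans (sym (not-involutive (odd m))) e))

half-induction : (P : ℕ → Set) → (∀ n → P (n + n)) → (∀ n → P (suc (n + n))) → ∀ n → P n
half-induction P even odd zero = even 0
half-induction P even odd (suc zero) = odd 0
half-induction P even odd (suc (suc n)) = half-induction (λ n → P (suc (suc n)))
  (λ n → subst P (cong suc (+-suc n n)) (even (suc n)))
  (λ n → subst P (cong (λ m → suc (suc m)) (+-suc n n)) (odd (suc n))) n

odd-double : ∀ n → odd (n + n) ≡ false
odd-double zero = refl
odd-double (suc n) = trans (cong (λ m → not (odd m)) (+-suc n n))
  (trans (not-involutive _) (odd-double n))

half-double : ∀ n → ⌊ n + n /2⌋ ≡ n
half-double n = sym (n≡⌊n+n/2⌋ n)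

half-suc-double : ∀ n → ⌊ suc (n + n) /2⌋ ≡ n
half-suc-double zero = refl
half-suc-double (suc n) = trans (cong (λ m → ⌊ suc (suc m) /2⌋) (+-suc n n)) (cong suc (half-suc-double n))

-- The first argument is fuel: any value above n gives the n-th term.
foldWith : ℕ → ℕ → Bool
foldWith zero    n = false
foldWith (suc k) n = if odd n then foldWith k ⌊ n /2⌋ else odd ⌊ n /2⌋

foldWith-fuel : ∀ {j k n} → n < j → n < k → foldWith j n ≡ foldWith k n
foldWith-fuel {suc j} {suc k} {zero} _ _ = refl
foldWith-fuel {suc j} {suc k} {suc n} (s≤s p) (s≤s q) with odd (suc n)
... | false = refl
... | true  = foldWith-fuel (<-≤-trans (⌊n/2⌋<n n) p) (<-≤-trans (⌊n/2⌋<n n) q)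

-- The regular paperfolding sequence, indexed from 0: the term is `true` exactly when the odd part
-- of `n + 1` is 3 modulo 4.
paperfold : ℕ → Bool
paperfold n = foldWith (suc n) n

paperfold-even : ∀ n → paperfold (n + n) ≡ odd n
paperfold-even n rewrite odd-double n | half-double n = refl

paperfold-odd : ∀ n → paperfold (suc (n + n)) ≡ paperfold n
paperfold-odd n rewrite odd-double n | half-suc-double n =
  foldWith-fuel (s≤s (m≤m+n n n)) (n<1+n n)

even-below : ∀ p → ∃₂ λ j n → j < 2 × p + j ≡ n + n
even-below = half-induction _
  (λ n → 0 , n , s≤s z≤n , +-identityʳ _)
  (λ n → 1 , suc n , s≤s (s≤s z≤n) , regroup n)
  where
  regroup : ∀ n → suc (n + n) + 1 ≡ suc n + suc n
  regroup = solve-∀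

even-half : ∀ e → 0 < e → odd e ≡ false → ∃ λ h → 0 < h × e ≡ h + h
even-half = half-induction _
  (λ { (suc n) _ _ → suc n , s≤s z≤n , refl })
  (λ n _ eq → contradiction (trans (sym (cong not (odd-double n))) eq) λ ())

odd-below : ∀ p → ∃₂ λ j n → j < 2 × p + j ≡ suc (n + n)
odd-below p with even-below (suc p)
... | j , zero , j<2 , ()
... | j , suc n , j<2 , eq = j , n , j<2 , trans (suc-injective eq) (+-suc n n)

-- At even positions the terms alternate, which excludes the periods 2e with e
-- odd; at odd positions the sequence is a copy of itself, which halves the
-- periods 2e with e even.
paperfold-no-even-square : ∀ e p → 0 < e → ¬ Square paperfold (e + e) p
paperfold-no-even-square e = halve e (<-wellFounded e)
  where
  shift-even : ∀ p j n e → p + j ≡ n + n → p + j + (e + e) ≡ (e + n) + (e + n)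
  shift-even p j n e eq = trans (cong (_+ (e + e)) eq) (regroup n e)
    where
    regroup : ∀ n e → n + n + (e + e) ≡ (e + n) + (e + n)
    regroup = solve-∀
  shift-odd : ∀ p j n i → p + j ≡ suc (n + n) → p + (j + (i + i)) ≡ suc ((n + i) + (n + i))
  shift-odd p j n i eq = trans (sym (+-assoc p j (i + i))) (trans (cong (_+ (i + i)) eq) (regroup n i))
    where
    regroup : ∀ n i → suc (n + n) + (i + i) ≡ suc ((n + i) + (n + i))
    regroup = solve-∀
  regroup₂ : ∀ m e → suc (m + m) + (e + e) ≡ suc ((m + e) + (m + e))
  regroup₂ = solve-∀
  j+2i< : ∀ {j i e} → j < 2 → i < e → j + (i + i) < e + e
  j+2i< {j} {i} {e} (s≤s j≤1) i<e = begin-strict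
    j + (i + i)  ≤⟨ +-monoˡ-≤ (i + i) j≤1 ⟩
    suc (i + i)  <⟨ ≤-reflexive (cong suc (sym (+-suc i i))) ⟩
    suc i + suc i ≤⟨ +-mono-≤ i<e i<e ⟩
    e + e ∎
    where open ≤-Reasoning
  halve : ∀ e → Acc _<_ e → ∀ p → 0 < e → ¬ Square paperfold (e + e) p
  halve e (acc rs) p 0<e sq with odd e in odd-e
  ... | true =
    let j , n , j<2 , eq = even-below p
        same : odd n ≡ odd (e + n)
        same = begin
          odd n                         ≡⟨ paperfold-even n ⟨
          paperfold (n + n)             ≡⟨ cong paperfold eq ⟨
          paperfold (p + j)             ≡⟨ sq j (<-≤-trans j<2 (+-mono-≤ 0<e 0<e)) ⟩
          paperfold (p + j + (e + e))   ≡⟨ cong paperfold (shift-even p j n e eq) ⟩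
          paperfold ((e + n) + (e + n)) ≡⟨ paperfold-even (e + n) ⟩
          odd (e + n)                   ∎
    in not-¬ (sym same) (odd-+ e n odd-e)
    where open ≡-Reasoning
  ... | false with even-half e 0<e odd-e
  ...   | h , 0<h , refl = halve h (rs (m<m+n h 0<h)) n 0<h sq′
    where
    open ≡-Reasoning
    j n : ℕ
    j = proj₁ (odd-below p)
    n = proj₁ (proj₂ (odd-below p))
    j<2 = proj₁ (proj₂ (proj₂ (odd-below p)))
    eqₒ = proj₂ (proj₂ (proj₂ (odd-below p)))
    sq′ : ∀ i → i < e → paperfold (n + i) ≡ paperfold (n + i + e)
    sq′ i i<e = begin
      paperfold (n + i)                       ≡⟨ paperfold-odd (n + i) ⟨
      paperfold (suc ((n + i) + (n + i)))     ≡⟨ cong paperfold (shift-odd p j n i eqₒ) ⟨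
      paperfold (p + (j + (i + i)))           ≡⟨ sq _ (j+2i< j<2 i<e) ⟩
      paperfold (p + (j + (i + i)) + (e + e)) ≡⟨ cong (λ m → paperfold (m + (e + e))) (shift-odd p j n i eqₒ) ⟩
      paperfold (suc ((n + i) + (n + i)) + (e + e)) ≡⟨ cong paperfold (regroup₂ (n + i) e) ⟩
      paperfold (suc ((n + i + e) + (n + i + e)))   ≡⟨ paperfold-odd (n + i + e) ⟩
      paperfold (n + i + e)                   ∎

-- The word is built from the blocks 0120, 0210, 3123 and 3213: the parity of the block number `q`
-- chooses the outer letter, the paperfolding term the order of 1 and 2.
outer left right : ℕ → Fin 4
outer q = if odd q then 3F else 0F
left  q = if paperfold q then 1F else 2F
right q = if paperfold q then 2F else 1F

-- In a square, the positions of the letters 1 and 2 force the period to be a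
-- multiple of 4, the outer letters 0 and 3 force it to be a multiple of 8, and
-- the inner letters then give a square of even period in the paperfolding word.
wordFrom : ℕ → ℕ → Fin 4
wordFrom q 0 = outer q
wordFrom q 1 = left q
wordFrom q 2 = right q
wordFrom q 3 = outer q
wordFrom q (suc (suc (suc (suc n)))) = wordFrom (suc q) n

word : ℕ → Fin 4
word = wordFrom 0

wordFrom-+ : ∀ q k n → wordFrom q (k * 4 + n) ≡ wordFrom (k + q) n
wordFrom-+ q zero    n = refl
wordFrom-+ q (suc k) n = trans (wordFrom-+ (suc q) k n) (cong (λ m → wordFrom m n) (+-suc k q))

outer≢left : ∀ q r → outer q ≢ left r
outer≢left q r with odd q | paperfold r
... | true  | true  = λ ()
... | true  | false = λ ()
... | false | true  = λ ()
... | false | false = λ ()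

outer≢right : ∀ q r → outer q ≢ right r
outer≢right q r with odd q | paperfold r
... | true  | true  = λ ()
... | true  | false = λ ()
... | false | true  = λ ()
... | false | false = λ ()

left≢right : ∀ q → left q ≢ right q
left≢right q with paperfold q
... | true  = λ ()
... | false = λ ()

outer≢outer-suc : ∀ q → outer q ≢ outer (suc q)
outer≢outer-suc q with odd q
... | true  = λ ()
... | false = λ ()

outer-injective : ∀ q r → outer q ≡ outer r → odd q ≡ odd r
outer-injective q r eq with odd q | odd r
... | true  | true  = refl
... | false | false = refl

left-injective : ∀ q r → left q ≡ left r → paperfold q ≡ paperfold r
left-injective q r eq with paperfold q | paperfold r
... | true  | true  = refl
... | false | false = refl

data Position : ℕ → Set where
  at : ∀ q r → r < 4 → Position (q * 4 + r)

position : ∀ n → Position n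
position n = subst Position (trans (+-comm (n / 4 * 4) (n % 4)) (sym (m≡m%n+[m/n]*n n 4)))
  (at (n / 4) (n % 4) (m%n<n n 4))

word-no-aligned-square : ∀ e q r → 0 < e → r < 4 →
  ¬ (∀ j → j < e * 4 → wordFrom q (r + j) ≡ wordFrom (e + q) (r + j))
word-no-aligned-square e q r 0<e r<4 sq with odd e in odd-e
... | true = not-¬ (sym (outer-injective q (e + q) (outers r<4 sq))) (odd-+ e q odd-e)
  where
  3<4e : 3 < e * 4
  3<4e = *-monoˡ-≤ 4 0<e
  -- The closing outer letter of block `q` stands 3 - `r` letters past the start; its copy in block
  -- `e + q` has the other parity when `e` is odd.
  outers : ∀ {r} → r < 4 → (∀ j → j < e * 4 → wordFrom q (r + j) ≡ wordFrom (e + q) (r + j)) →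
    outer q ≡ outer (e + q)
  outers {0} _ sq = sq 3 3<4e
  outers {1} _ sq = sq 2 (<-trans (n<1+n _) 3<4e)
  outers {2} _ sq = sq 1 (<-trans (s≤s (s≤s z≤n)) 3<4e)
  outers {3} _ sq = sq 0 (<-trans (s≤s z≤n) 3<4e)
  outers {suc (suc (suc (suc _)))} (s≤s (s≤s (s≤s (s≤s ())))) _
... | false with even-half e 0<e odd-e
...   | h , 0<h , refl = lefts r<4 sq
  where
  square : ∀ n → (∀ i → i < e → left (i + n) ≡ left (i + (e + n))) → ⊥
  square n f = paperfold-no-even-square h n 0<h λ i i<2h →
    trans (cong paperfold (+-comm n i)) (trans (left-injective (i + n) (i + (h + h + n)) (f i i<2h))
      (cong paperfold (regroup i e n)))
    where
    regroup : ∀ i e n → i + (e + n) ≡ n + i + e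
    regroup = solve-∀
  low : ∀ {i} t → t < 4 → i < e → i * 4 + t < e * 4
  low {i} t t<4 i<e = <-≤-trans (+-monoʳ-< (i * 4) t<4) (≤-trans (≤-reflexive (+-comm (i * 4) 4)) (*-monoˡ-≤ 4 i<e))
  shift : ∀ c i t → c + (i * 4 + t) ≡ i * 4 + (c + t)
  shift = solve-∀
  move : ∀ {r} t i → wordFrom q (r + (i * 4 + t)) ≡ wordFrom (e + q) (r + (i * 4 + t)) →
    wordFrom (i + q) (r + t) ≡ wordFrom (i + (e + q)) (r + t)
  move {r} t i eq = trans (sym (wordFrom-+ q i (r + t))) (trans (cong (wordFrom q) (sym (shift r i t)))
    (trans eq (trans (cong (wordFrom (e + q)) (shift r i t)) (wordFrom-+ (e + q) i (r + t)))))
  -- `move` is given the distance from residue `r` to the next left letter, at residue 1. For `r`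
  -- equal to 2 or 3 that letter is in the next block, so the paperfolding square starts at `suc q`.
  lefts : ∀ {r} → r < 4 → (∀ j → j < e * 4 → wordFrom q (r + j) ≡ wordFrom (e + q) (r + j)) → ⊥
  suc-lefts : (∀ i → i < e → left (suc (i + q)) ≡ left (suc (i + (e + q)))) → ⊥
  suc-lefts f = square (suc q) λ i i<e → trans (cong left (+-suc i q))
    (trans (f i i<e) (cong left (trans (sym (+-suc i (e + q))) (cong (i +_) (sym (+-suc e q))))))
  lefts {0} _ sq = square q λ i i<e → move {0} 1 i (sq _ (low 1 (s≤s (s≤s z≤n)) i<e))
  lefts {1} _ sq = square q λ i i<e → move {1} 0 i (sq _ (low 0 (s≤s z≤n) i<e))
  lefts {2} _ sq = suc-lefts λ i i<e → move {2} 3 i (sq _ (low 3 ≤-refl i<e))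
  lefts {3} _ sq = suc-lefts λ i i<e → move {3} 2 i (sq _ (low 2 (s≤s (s≤s (s≤s z≤n))) i<e))
  lefts {suc (suc (suc (suc _)))} (s≤s (s≤s (s≤s (s≤s ())))) _

word-squarefree : ∀ D p → 0 < D → ¬ Square word D p
word-squarefree D p 0<D sq with position D | position p
... | at e d d<4 | at q r r<4 = go d<4 r<4 0<D shifted
  where
  regroup : ∀ q r j e d → q * 4 + r + j + (e * 4 + d) ≡ (e + q) * 4 + (d + (r + j))
  regroup = solve-∀
  at-block : ∀ q n → word (q * 4 + n) ≡ wordFrom q n
  at-block q n = trans (wordFrom-+ 0 q n) (cong (λ m → wordFrom m n) (+-identityʳ q))
  shifted : ∀ j → j < e * 4 + d → wordFrom q (r + j) ≡ wordFrom (e + q) (d + (r + j))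
  shifted j j<D = trans (sym (at-block q (r + j))) (trans (cong word (sym (+-assoc (q * 4) r j)))
    (trans (sq j j<D) (trans (cong word (regroup q r j e d)) (at-block (e + q) (d + (r + j))))))
  -- For `d` nonzero, one of the first two comparisons pairs an outer letter with an inner one. The
  -- exceptions have period 1: left against right within a block, and the outer letters of
  -- consecutive blocks.
  go : ∀ {e d r} → d < 4 → r < 4 → 0 < e * 4 + d →
    ¬ (∀ j → j < e * 4 + d → wordFrom q (r + j) ≡ wordFrom (e + q) (d + (r + j)))
  go {zero}  {0} _ _ () _
  go {suc e} {0} {r} _ r<4 _ sq = word-no-aligned-square (suc e) q r (s≤s z≤n) r<4
    λ j j<D → sq j (subst (j <_) (sym (+-identityʳ _)) j<D)
  go {e}     {1} {0} _ _ 0<D sq = outer≢left q (e + q) (sq 0 0<D)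
  go {zero}  {1} {1} _ _ 0<D sq = left≢right q (sq 0 0<D)
  go {suc e} {1} {1} _ _ 0<D sq = outer≢right (suc (e + q)) q (sym (sq 1 (s≤s (s≤s z≤n))))
  go {e}     {1} {2} _ _ 0<D sq = outer≢right (e + q) q (sym (sq 0 0<D))
  go {zero}  {1} {3} _ _ 0<D sq = outer≢outer-suc q (sq 0 0<D)
  go {suc e} {1} {3} _ _ 0<D sq = outer≢left (suc q) (suc (suc (e + q))) (sq 1 (s≤s (s≤s z≤n)))
  go {e}     {2} {0} _ _ 0<D sq = outer≢right q (e + q) (sq 0 0<D)
  go {e}     {2} {1} _ _ 0<D sq = outer≢left (e + q) q (sym (sq 0 0<D))
  go {e}     {2} {2} _ _ 0<D sq = outer≢right (suc (e + q)) q (sym (sq 0 0<D))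
  go {e}     {2} {3} _ _ 0<D sq = outer≢left q (suc (e + q)) (sq 0 0<D)
  go {e}     {3} {0} _ _ 0<D sq = outer≢left (suc (e + q)) q (sym (sq 1 (≤-trans (s≤s (s≤s z≤n)) (m≤n+m 3 (e * 4)))))
  go {e}     {3} {1} _ _ 0<D sq = outer≢left (suc (e + q)) q (sym (sq 0 0<D))
  go {e}     {3} {2} _ _ 0<D sq = outer≢right q (suc (e + q)) (sq 1 (≤-trans (s≤s (s≤s z≤n)) (m≤n+m 3 (e * 4))))
  go {e}     {3} {3} _ _ 0<D sq = outer≢right q (suc (e + q)) (sq 0 0<D)
  go {_} {suc (suc (suc (suc _)))} (s≤s (s≤s (s≤s (s≤s ())))) _ _ _
  go {_} {_} {suc (suc (suc (suc _)))} _ (s≤s (s≤s (s≤s (s≤s ())))) _ _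

word-suc : ∀ n → word n ≢ word (suc n)
word-suc n eq = word-squarefree 1 n (s≤s z≤n) λ
  { zero _ → trans (cong word (+-identityʳ n)) (trans eq (cong word (sym (trans (+-comm _ 1) (cong suc (+-identityʳ n))))))
  ; (suc _) (s≤s ()) }

word-suc² : ∀ n → word n ≢ word (suc (suc n))
word-suc² n = go 0 n
  where
  go : ∀ q n → wordFrom q n ≢ wordFrom q (suc (suc n))
  go q 0 = outer≢right q q
  go q 1 eq = outer≢left q q (sym eq)
  go q 2 eq = outer≢right (suc q) q (sym eq)
  go q 3 = outer≢left q (suc q)
  go q (suc (suc (suc (suc n)))) = go (suc q) n

-- Pairs of equally coloured walks on the line

data Direction : Set where
  up down : Direction

data Move : Direction → ℕ → ℕ → Set where
  rise : ∀ {p} → Move up p (suc p)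
  fall : ∀ {p} → Move down (suc p) p

Near : ℕ → ℕ → Set
Near p q = p ≡ q ⊎ ∃ λ d → Move d p q

near-sym : ∀ {p q} → Near p q → Near q p
near-sym (inj₁ eq)         = inj₁ (sym eq)
near-sym (inj₂ (_ , rise)) = inj₂ (_ , fall)
near-sym (inj₂ (_ , fall)) = inj₂ (_ , rise)

module ColouredLine {C : Set} (word : ℕ → C)
  (word-suc        : ∀ n → word n ≢ word (suc n))
  (word-suc²       : ∀ n → word n ≢ word (suc (suc n)))
  (word-squarefree : ∀ D p → 0 < D → ¬ Square word D p) where

  move⇒≢ : ∀ {d p q} → Move d p q → word p ≢ word q
  move⇒≢ rise   = word-suc _
  move⇒≢ fall eq = word-suc _ (sym eq)

  turn-or-continue : ∀ {d d′ p p′ p″} → Move d p p′ → Move d′ p′ p″ →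
    d ≡ d′ × word p ≢ word p″ ⊎ p ≡ p″
  turn-or-continue rise rise = inj₁ (refl , word-suc² _)
  turn-or-continue rise fall = inj₂ refl
  turn-or-continue fall rise = inj₂ refl
  turn-or-continue fall fall = inj₁ (refl , λ eq → word-suc² _ (sym eq))

  near-determined : ∀ {p q r} → Near p q → Near p r → word q ≡ word r → q ≡ r
  near-determined (inj₁ refl)       (inj₁ refl)       _  = refl
  near-determined (inj₁ refl)       (inj₂ (_ , m))    eq = contradiction eq (move⇒≢ m)
  near-determined (inj₂ (_ , m))    (inj₁ refl)       eq = contradiction (sym eq) (move⇒≢ m)
  near-determined (inj₂ (_ , rise)) (inj₂ (_ , rise)) _  = refl
  near-determined (inj₂ (_ , fall)) (inj₂ (_ , fall)) _  = refl
  near-determined (inj₂ (_ , rise)) (inj₂ (_ , fall)) eq = contradiction (sym eq) (word-suc² _)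
  near-determined (inj₂ (_ , fall)) (inj₂ (_ , rise)) eq = contradiction eq (word-suc² _)

  -- A pair of equally coloured straight paths, from x to p and from y to q.
  data Run (dx dy : Direction) (x y : ℕ) : ℕ → ℕ → Set where
    start : word x ≡ word y → Run dx dy x y x y
    step  : ∀ {p q p′ q′} → Run dx dy x y p q → Move dx p p′ → Move dy q q′ →
            word p′ ≡ word q′ → Run dx dy x y p′ q′

  run-end : ∀ {dx dy x y p q} → Run dx dy x y p q → word p ≡ word q
  run-end (start eq)      = eq
  run-end (step _ _ _ eq) = eq

  run-swap : ∀ {dx dy x y p q} → Run dx dy x y p q → Run dy dx y x q p
  run-swap (start eq)      = start (sym eq)
  run-swap (step r m n eq) = step (run-swap r) n m (sym eq)

  -- Since the colouring is injective on every three consecutive positions, two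
  -- equally coloured walks turn back simultaneously; cutting the turns off leaves a run.
  extend : ∀ {x y p q p′ q′} → ∃₂ (λ dx dy → Run dx dy x y p q) →
    Near p p′ → Near q q′ → word p′ ≡ word q′ → ∃₂ λ dx dy → Run dx dy x y p′ q′
  extend r (inj₁ refl) (inj₁ refl) _ = r
  extend (_ , _ , r) (inj₁ refl) (inj₂ (_ , m)) eq =
    contradiction (trans (sym (run-end r)) eq) (move⇒≢ m)
  extend (_ , _ , r) (inj₂ (_ , m)) (inj₁ refl) eq =
    contradiction (trans (run-end r) (sym eq)) (move⇒≢ m)
  extend (_ , _ , start e) (inj₂ (_ , m)) (inj₂ (_ , n)) eq = _ , _ , step (start e) m n eq
  extend (_ , _ , step r m n e) (inj₂ (_ , m′)) (inj₂ (_ , n′)) eq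
    with turn-or-continue m m′ | turn-or-continue n n′
  ... | inj₁ (refl , _) | inj₁ (refl , _) = _ , _ , step (step r m n e) m′ n′ eq
  ... | inj₁ (_ , ≢)    | inj₂ refl       = contradiction (trans (run-end r) (sym eq)) ≢
  ... | inj₂ refl       | inj₁ (_ , ≢)    = contradiction (trans (sym (run-end r)) eq) ≢
  ... | inj₂ refl       | inj₂ refl       = _ , _ , r

  run-up-up : ∀ {x y p q} → Run up up x y p q →
    ∃ λ l → p ≡ l + x × q ≡ l + y × (∀ j → j ≤ l → word (j + x) ≡ word (j + y))
  run-up-up (start eq) = 0 , refl , refl , λ { zero _ → eq }
  run-up-up (step r rise rise eq) with run-up-up r
  ... | l , refl , refl , f = suc l , refl , refl , λ j j≤ → extended j (m≤n⇒m<n∨m≡n j≤)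
    where
    extended : ∀ j → j < suc l ⊎ j ≡ suc l → _
    extended j (inj₁ (s≤s j≤l)) = f j j≤l
    extended _ (inj₂ refl)      = eq

  run-down-down : ∀ {x y p q} → Run down down x y p q →
    ∃ λ l → x ≡ l + p × y ≡ l + q × (∀ j → j ≤ l → word (j + p) ≡ word (j + q))
  run-down-down (start eq) = 0 , refl , refl , λ { zero _ → eq }
  run-down-down (step {p′ = p} {q} r fall fall eq) with run-down-down r
  ... | l , refl , refl , f = suc l , +-suc l p , +-suc l q , λ
    { zero    _         → eq
    ; (suc j) (s≤s j≤l) → subst₂ (λ a b → word a ≡ word b) (+-suc j p) (+-suc j q) (f j j≤l) }

  -- After `i` steps the second path, descending from `l + q`, stands at `j + q` with `i + j ≡ l`;
  -- so the two paths are reflections rather than translates.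
  run-up-down : ∀ {x y p q} → Run up down x y p q →
    ∃ λ l → p ≡ l + x × y ≡ l + q × (∀ i j → i + j ≡ l → word (i + x) ≡ word (j + q))
  run-up-down (start eq) = 0 , refl , refl , λ { zero zero _ → eq }
  run-up-down (step {q′ = q} r rise fall eq) with run-up-down r
  ... | l , refl , refl , f = suc l , refl , +-suc l q , λ
    { i zero    i≡    → trans (cong (λ m → word (m + _)) (trans (sym (+-identityʳ i)) i≡)) eq
    ; i (suc j) i+j≡l → trans (f i j (suc-injective (trans (sym (+-suc i j)) i+j≡l)))
                              (cong word (+-suc j q)) }

  no-long-translate : ∀ {x D l} → D ≤ suc l →
    (∀ j → j ≤ l → word (j + x) ≡ word (j + (D + x))) → D ≡ 0
  no-long-translate {D = zero} _ _ = refl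
  no-long-translate {x} {suc D} (s≤s D≤l) f = ⊥-elim (word-squarefree (suc D) x (s≤s z≤n) λ
    { j (s≤s j≤D) → subst₂ (λ a b → word a ≡ word b) (+-comm j x)
        (trans (cong (j +_) (+-comm (suc D) x))
               (trans (sym (+-assoc j x (suc D))) (cong (_+ suc D) (+-comm j x))))
        (f j (≤-trans j≤D D≤l)) })

  -- The offset `D` from `x` to `y` differs from `l` by at most one, so for positive `l` the `l + 1`
  -- equalities cover a whole square of period `D` unless `D` is 0.
  translate-near : ∀ l {x y} → (∀ j → j ≤ l → word (j + x) ≡ word (j + y)) → Near (l + x) y → x ≡ y
  translate-near zero f n = near-determined (inj₁ refl) n (f 0 z≤n)
  translate-near (suc l) {x} f (inj₁ refl) with () ← no-long-translate {x} (n≤1+n (suc l)) f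
  translate-near (suc l) {x} f (inj₂ (_ , rise)) with () ← no-long-translate {x} ≤-refl f
  translate-near (suc l) {x} f (inj₂ (_ , fall)) =
    sym (cong (_+ x) (no-long-translate (≤-trans (n≤1+n l) (n≤1+n _)) f))

  -- Near the centre of the reflection, two positions at distance 1 or 2 get equal letters. Only the
  -- one-point path with `x ≡ q` escapes.
  reflection-near : ∀ l {x q} → (∀ i j → i + j ≡ l → word (i + x) ≡ word (j + q)) → Near x q →
    l ≡ 0 × x ≡ q
  reflection-near = half-induction _ even odd-case
    where
    even : ∀ n {x q} → (∀ i j → i + j ≡ n + n → word (i + x) ≡ word (j + q)) → Near x q →
      n + n ≡ 0 × x ≡ q
    even zero    f (inj₁ refl) = refl , refl
    even (suc n) f (inj₁ refl) = contradiction (f n (suc (suc n)) (+-suc n (suc n))) (word-suc² _)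
    even n {x} f (inj₂ (_ , rise)) = contradiction (trans (f n n refl) (cong word (+-suc n x))) (word-suc _)
    even n {q = q} f (inj₂ (_ , fall)) =
      contradiction (trans (sym (f n n refl)) (cong word (+-suc n q))) (word-suc _)
    odd-case : ∀ n {x q} → (∀ i j → i + j ≡ suc (n + n) → word (i + x) ≡ word (j + q)) → Near x q →
      suc (n + n) ≡ 0 × x ≡ q
    odd-case n f (inj₁ refl) = contradiction (f n (suc n) (+-suc n n)) (word-suc _)
    odd-case n {x} f (inj₂ (_ , rise)) = contradiction
      (trans (f n (suc n) (+-suc n n)) (cong (λ m → word (suc m)) (+-suc n x))) (word-suc² _)
    odd-case n {q = q} f (inj₂ (_ , fall)) = contradiction
      (trans (sym (f (suc n) n refl)) (cong (λ m → word (suc m)) (+-suc n q))) (word-suc² _)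

  near-cancel : ∀ l {x q} → Near (l + x) (l + q) → Near x q
  near-cancel zero    n = n
  near-cancel (suc l) n = near-cancel l (pred-near n)
    where
    pred-near : ∀ {a b} → Near (suc a) (suc b) → Near a b
    pred-near (inj₁ refl) = inj₁ refl
    pred-near (inj₂ (_ , rise)) = inj₂ (_ , rise)
    pred-near (inj₂ (_ , fall)) = inj₂ (_ , fall)

  run-near : ∀ {dx dy x y p q} → Run dx dy x y p q → Near p y → x ≡ y
  run-near {up} {up} r n with run-up-up r
  ... | l , refl , _ , f = translate-near l f n
  run-near {down} {down} r n with run-down-down r
  ... | l , refl , refl , f = cong (l +_) (sym (translate-near l (λ j j≤l → sym (f j j≤l)) (near-sym n)))
  run-near {up} {down} r n with run-up-down r
  ... | l , refl , refl , f with reflection-near l f (near-cancel l n)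
  ...   | refl , x≡q = x≡q
  run-near {down} {up} r n with run-up-down (run-swap r)
  ... | l , refl , refl , f with reflection-near l f (near-sym n)
  ...   | refl , y≡p = sym y≡p

  ColouredStep : ℕ × ℕ → ℕ × ℕ → Set
  ColouredStep (p , q) (p′ , q′) = Near p p′ × Near q q′ × word p′ ≡ word q′

  -- Cutting off turns keeps the first and the last pair, so only runs matter. Equality of the first
  -- pair suffices: `near-determined` later carries it along the walk.
  word-walk-nonrepetitive : ∀ {x y p q} → word x ≡ word y →
    Star ColouredStep (x , y) (p , q) → Near p y → x ≡ y
  -- The directions of an empty run are arbitrary, since `extend` chooses them anew.
  word-walk-nonrepetitive eq w n = run-near (proj₂ (proj₂ (run w (up , up , start eq)))) n
    where
    run : ∀ {x y p q p′ q′} → Star ColouredStep (p , q) (p′ , q′) →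
      ∃₂ (λ dx dy → Run dx dy x y p q) → ∃₂ λ dx dy → Run dx dy x y p′ q′
    run ε r = r
    run ((m , n , eq) ◅ w) r = run w (extend r m n eq)

open ColouredLine word word-suc word-suc² word-squarefree

-- Layers of chordal graphs

LazyAdjacent : {V : Set} → (V → List V) → V → V → Set
LazyAdjacent back u v = u ≡ v ⊎ u ∈ˡ back v ⊎ v ∈ˡ back u

lazy-sym : ∀ {V : Set} {back : V → List V} {u v} →
  LazyAdjacent back u v → LazyAdjacent back v u
lazy-sym (inj₁ eq) = inj₁ (sym eq)
lazy-sym (inj₂ a)  = inj₂ (swap a)

-- A chordal graph with a perfect elimination ordering: back v lists the at
-- most k neighbours of v that precede v, and these form a clique.
record Chordal (V : Set) (k : ℕ) : Set where
  field
    back         : V → List V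
    rank         : V → ℕ
    back-<       : ∀ {u v} → u ∈ˡ back v → rank u < rank v
    back-clique  : ∀ {u v w} → u ∈ˡ back v → w ∈ˡ back v → LazyAdjacent back u w
    back-bounded : ∀ v → length (back v) ≤ k

Bad : {V C : Set} → (V → C) → V × V → Set
Bad φ (a , b) = a ≢ b × φ a ≡ φ b

-- A repetitive lazy walk v₁, …, v₂ₜ is seen as the walk of the pairs (vᵢ , vᵢ₊ₜ).
PairStep : {V C : Set} → (V → V → Set) → (V → C) → V × V → V × V → Set
PairStep _~_ φ (a , b) (a′ , b′) = (a ~ a′) × (b ~ b′) × Bad φ (a′ , b′)

-- Here `x` is the last vertex of the first half and `b` the first vertex of the second; `x ~ b`
-- joins the halves into one lazy walk.
NoViolation : {V C : Set} → (V → V → Set) → (V → C) → Set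
NoViolation _~_ φ = ∀ {a b x y} → Bad φ (a , b) → Star (PairStep _~_ φ) (a , b) (x , y) → ¬ (x ~ b)

-- The value at the empty list puts the vertices without earlier neighbours in layer 0.
sucMin : List ℕ → ℕ
sucMin []       = 0
sucMin (n ∷ ns) = suc (min n ns)

sucMin≤ : ∀ {n ns} → n ∈ˡ ns → sucMin ns ≤ suc n
sucMin≤ {ns = n ∷ ns} (here refl) = s≤s (min≤⊤ n ns)
sucMin≤ {ns = n ∷ ns} (there n∈)  = s≤s (All.lookup (min≤xs n ns) n∈)

sucMin-attained : ∀ {n ns} → n ∈ˡ ns → ∃ λ m → m ∈ˡ ns × sucMin ns ≡ suc m
sucMin-attained {ns = n ∷ ns} _ with argmin-sel id n ns
... | inj₁ eq  = n , here refl , cong suc eq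
... | inj₂ min∈ = _ , there min∈ , refl

module Layering {V : Set} {k : ℕ} (H : Chordal V (suc k)) where
  open Chordal H

  infix 4 _~_
  _~_ : V → V → Set
  _~_ = LazyAdjacent back

  -- The first argument is fuel: any value above rank v gives the level of v.
  levelWith : ℕ → V → ℕ
  levelWith zero    v = 0
  levelWith (suc j) v = sucMin (map (levelWith j) (back v))

  levelWith-fuel : ∀ {i j v} → rank v < i → rank v < j → levelWith i v ≡ levelWith j v
  levelWith-fuel {suc i} {suc j} (s≤s p) (s≤s q) = cong sucMin (map-cong-local (All.tabulate λ u∈ →
    levelWith-fuel (<-≤-trans (back-< u∈) p) (<-≤-trans (back-< u∈) q)))

  level : V → ℕ
  level v = levelWith (suc (rank v)) v

  level-unfold : ∀ v → level v ≡ sucMin (map level (back v))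
  level-unfold v = cong sucMin (map-cong-local (All.tabulate λ {u} u∈ →
    levelWith-fuel {rank v} {suc (rank u)} (back-< u∈) ≤-refl))

  level≤suc : ∀ {u v} → u ∈ˡ back v → level v ≤ suc (level u)
  level≤suc {v = v} u∈ rewrite level-unfold v = sucMin≤ (∈-map⁺ level u∈)

  level-attained : ∀ {u v} → u ∈ˡ back v → ∃ λ w → w ∈ˡ back v × level v ≡ suc (level w)
  level-attained {v = v} u∈ with sucMin-attained (∈-map⁺ level u∈)
  ... | _ , m∈ , eq with ∈-map⁻ level m∈
  ...   | w , w∈ , refl = w , w∈ , trans (level-unfold v) eq

  -- Take `w` in `back v` one level below `v`. By the clique property `u` is `w`, or precedes `w`
  -- (induction), or has `w` as an earlier neighbour and so lies at most one level above it.
  level-mono : ∀ {u v} → u ∈ˡ back v → level u ≤ level v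
  level-mono {v = v} = go (<-wellFounded (rank v))
    where
    go : ∀ {u v} → Acc _<_ (rank v) → u ∈ˡ back v → level u ≤ level v
    go (acc rs) u∈ with level-attained u∈
    ... | w , w∈ , eq with back-clique u∈ w∈
    ...   | inj₁ refl = ≤-trans (n≤1+n _) (≤-reflexive (sym eq))
    ...   | inj₂ (inj₁ u∈w) = ≤-trans (go (rs (back-< w∈)) u∈w) (≤-trans (n≤1+n _) (≤-reflexive (sym eq)))
    ...   | inj₂ (inj₂ w∈u) = ≤-trans (level≤suc w∈u) (≤-reflexive (sym eq))

  level-near : ∀ {u v} → u ~ v → Near (level u) (level v)
  level-near (inj₁ refl)      = inj₁ refl
  level-near (inj₂ (inj₂ v∈)) = near-sym (level-near (inj₂ (inj₁ v∈)))
  level-near (inj₂ (inj₁ u∈)) with m≤n⇒m<n∨m≡n (level-mono u∈)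
  ... | inj₂ eq = inj₁ eq
  ... | inj₁ u<v = inj₂ (up , subst (Move up _) (≤-antisym u<v (level≤suc u∈)) rise)

  layerBack : V → List V
  layerBack v = filter (λ u → level u ≟ℕ level v) (back v)

  within-layer : ∀ {u v} → level u ≡ level v → u ~ v → LazyAdjacent layerBack u v
  within-layer _ (inj₁ eq)         = inj₁ eq
  within-layer e (inj₂ (inj₁ u∈)) = inj₂ (inj₁ (∈-filter⁺ (λ u → level u ≟ℕ _) u∈ e))
  within-layer e (inj₂ (inj₂ v∈)) = inj₂ (inj₂ (∈-filter⁺ (λ u → level u ≟ℕ _) v∈ (sym e)))

  layer : Chordal V k
  layer = record
    { back         = layerBack
    ; rank         = rank
    ; back-<       = λ u∈ → back-< (proj₁ (∈-filter⁻ (λ u → level u ≟ℕ _) u∈))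
    ; back-clique  = λ u∈ w∈ →
        let u∈b , u≡ = ∈-filter⁻ (λ u → level u ≟ℕ _) u∈
            w∈b , w≡ = ∈-filter⁻ (λ u → level u ≟ℕ _) w∈
        in within-layer (trans u≡ (sym w≡)) (back-clique u∈b w∈b)
    ; back-bounded = λ v → bounded v (back v) refl
    }
    where
    -- A nonempty `back v` has a member one level below `v`, which the filter drops; this lowers the
    -- bound from `suc k` to `k`.
    bounded : ∀ v us → us ≡ back v → length (filter (λ u → level u ≟ℕ level v) us) ≤ k
    bounded v []       _  = z≤n
    bounded v (u ∷ us) eq with level-attained (subst (u ∈ˡ_) eq (here refl))
    ... | w , w∈ , lv = s≤s⁻¹ (≤-trans
            (filter-notAll (λ u → level u ≟ℕ level v) (u ∷ us) (lose (subst (w ∈ˡ_) (sym eq) w∈) λ same → 1+n≢n (trans (sym lv) (sym same))))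
            (subst (λ us → length us ≤ suc k) (sym eq) (back-bounded v)))

  lower⇒back : ∀ {u v} → u ~ v → level u < level v → u ∈ˡ back v
  lower⇒back (inj₁ refl)      u<v = contradiction u<v (<-irrefl refl)
  lower⇒back (inj₂ (inj₁ u∈)) _   = u∈
  lower⇒back (inj₂ (inj₂ v∈)) u<v = contradiction (level-mono v∈) (<⇒≱ u<v)

  High Descent : ℕ → V → V → Set
  High d u v    = d < level u × d < level v × u ~ v
  Descent d u v = v ∈ˡ back u × d < level v

  -- If `x` precedes `w` and `w` descends to `w₁`, then both lie in the clique `back w`, so the edge
  -- from `x` to `w` can be replaced by one from `x` to `w₁`.
  confluence : ∀ {d x w z} → x ~ w → d < level x → d < level w → Star (Descent d) w z →
    ∃ λ z′ → Star (Descent d) x z′ × Star (Descent d) z z′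
  confluence (inj₁ refl)      _   _   w↘z = _ , w↘z , ε
  confluence (inj₂ (inj₂ w∈)) _   d<w w↘z = _ , (w∈ , d<w) ◅ w↘z , ε
  confluence (inj₂ (inj₁ x∈)) d<x _   ε   = _ , ε , (x∈ , d<x) ◅ ε
  confluence (inj₂ (inj₁ x∈)) d<x _ ((w₁∈ , d<w₁) ◅ w₁↘z) =
    confluence (back-clique x∈ w₁∈) d<x d<w₁ w₁↘z

  common-descent : ∀ {d x w} → Star (High d) x w →
    ∃ λ z → Star (Descent d) x z × Star (Descent d) w z
  common-descent ε = _ , ε , ε
  common-descent ((d<x , d<x₁ , a) ◅ s) with common-descent s
  ... | _ , x₁↘z , w↘z with confluence a d<x d<x₁ x₁↘z
  ...   | _ , x↘z′ , z↘z′ = _ , x↘z′ , w↘z ◅◅ z↘z′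

  -- `y` and the next vertex share a back clique, and the lower level of `y` makes it the earlier
  -- one. So `y` stays an earlier neighbour down to a common descendant, whose back clique settles
  -- `shadow`.
  back-descent : ∀ {y x z} → y ∈ˡ back x → Star (Descent (level y)) x z → y ∈ˡ back z
  back-descent y∈ ε = y∈
  back-descent y∈ ((x₁∈ , y<x₁) ◅ s) = back-descent (lower⇒back (back-clique y∈ x₁∈) y<x₁) s

  -- Layers are shadow-complete: the neighbours in a layer of a connected set
  -- of higher vertices form a clique.
  shadow : ∀ {y y′ x x′} → level y ≡ level y′ → y ∈ˡ back x → y′ ∈ˡ back x′ →
    Star (High (level y)) x x′ → y ~ y′
  shadow {y} {y′} eq y∈ y′∈ s with common-descent s
  ... | _ , x↘z , x′↘z = back-clique (back-descent y∈ x↘z)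
    (back-descent y′∈ (subst (λ d → Star (Descent d) _ _) eq x′↘z))

  -- A stretch of walk above the layer of `y`, kept only as connectivity to a neighbour of `y`; it
  -- serves both before and after a visit to the layer.
  data Excursion (y : V) : V → Set where
    here : Excursion y y
    away : ∀ {z c} → y ∈ˡ back z → Star (High (level y)) z c → level y < level c → Excursion y c

  excursion-step : ∀ {y c c′} → Excursion y c → c ~ c′ → level y < level c′ → Excursion y c′
  excursion-step here           a y<c′ = away (lower⇒back a y<c′) ε y<c′
  excursion-step (away y∈ s y<c) a y<c′ = away y∈ (s ◅◅ ((y<c , y<c′ , a) ◅ ε)) y<c′

  excursion-meet : ∀ {y y′ c} → level y ≡ level y′ → Excursion y c → Excursion y′ c → y ~ y′
  excursion-meet eq here here = inj₁ refl
  excursion-meet eq here (away _ _ y′<y) = contradiction y′<y (<-irrefl (sym eq))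
  excursion-meet eq (away _ _ y<y′) here = contradiction y<y′ (<-irrefl eq)
  excursion-meet eq (away y∈ s _) (away y′∈ s′ _) = shadow eq y∈ y′∈
    (s ◅◅ reverse (λ (p , q , a) → q , p , lazy-sym a) (subst (λ d → Star (High d) _ _) (sym eq) s′))

  -- Unless both excursions are trivial, one of them can be extended across the edge, and then they
  -- meet in one vertex.
  excursion-join : ∀ {y y′ c c′} → level y ≡ level y′ → Excursion y c → c ~ c′ → Excursion y′ c′ → y ~ y′
  excursion-join eq here a here = a
  excursion-join eq e a e′@(away _ _ y′<c′) =
    excursion-meet eq (excursion-step e a (subst (_< _) (sym eq) y′<c′)) e′
  excursion-join eq e@(away _ _ y<c) a here =
    excursion-meet eq e (excursion-step here (lazy-sym a) (subst (_< _) eq y<c))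

  module _ {C : Set} (φ : V → C) where

    -- The part in its lowest layer of a pair walk starting at (a , b) whose
    -- first coordinate ends at x; a₀, b₀ and a₁, b₁ are the first and the last
    -- pair in that layer.
    record LowestPart (a b x : V) : Set where
      field
        {a₀ b₀ a₁ b₁} : V
        level-b₀ : level a₀ ≡ level b₀
        level-a₁ : level a₀ ≡ level a₁
        bad      : Bad φ (a₀ , b₀)
        inside   : Star (PairStep (LazyAdjacent layerBack) φ) (a₀ , b₀) (a₁ , b₁)
        before-a : Excursion a₀ a
        before-b : Excursion b₀ b
        after    : Excursion a₁ x
        lowest   : level a₀ ≤ level a
        climb    : ∀ {y} → level y < level a₀ → Excursion y a → Excursion y x

    trivialPart : ∀ {a b x} → level a ≡ level b → Bad φ (a , b) → Excursion a x →
      (∀ {y} → level y < level a → Excursion y a → Excursion y x) → LowestPart a b x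
    trivialPart eq bad e climb = record
      { level-b₀ = eq ; level-a₁ = refl ; bad = bad ; inside = ε
      ; before-a = here ; before-b = here ; after = e ; lowest = ≤-refl ; climb = climb }

    -- A pair below the old lowest layer starts a new one, and `climb` turns the whole old walk into
    -- an excursion. A pair in that layer is linked to the old first pair by a shortcut under the
    -- excursions. A higher pair lengthens the excursions before it.
    prepend : ∀ {a b a′ b′ x} → level a ≡ level b → Bad φ (a , b) → a ~ a′ → b ~ b′ →
      LowestPart a′ b′ x → LowestPart a b x
    prepend {a} {b} {a′} {b′} {x} eq bad p q rest with <-cmp (level a) (level (LowestPart.a₀ rest))
    ... | tri< a<a₀ _ _ = trivialPart eq bad
            (climb a<a₀ (excursion-step here p (<-≤-trans a<a₀ lowest)))
            (λ y<a e → climb (<-trans y<a a<a₀) (excursion-step e p (<-≤-trans (<-trans y<a a<a₀) lowest)))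
      where open LowestPart rest hiding (bad)
    ... | tri≈ _ a≡a₀ _ = record
            { level-b₀ = eq ; level-a₁ = trans a≡a₀ (R.level-a₁) ; bad = bad
            ; inside = ( within-layer a≡a₀ (excursion-join a≡a₀ here p R.before-a)
                       , within-layer b≡b₀ (excursion-join b≡b₀ here q R.before-b)
                       , R.bad ) ◅ R.inside
            ; before-a = here ; before-b = here ; after = R.after ; lowest = ≤-refl
            ; climb = λ y<a e → R.climb (subst (_ <_) a≡a₀ y<a)
                (excursion-step e p (<-≤-trans (subst (_ <_) a≡a₀ y<a) R.lowest)) }
      where
      module R = LowestPart rest
      b≡b₀ = trans (sym eq) (trans a≡a₀ R.level-b₀)
    ... | tri> _ _ a₀<a = record
            { level-b₀ = level-b₀ ; level-a₁ = level-a₁ ; bad = bad₀ ; inside = inside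
            ; before-a = excursion-step before-a (lazy-sym p) a₀<a
            ; before-b = excursion-step before-b (lazy-sym q) (subst₂ _<_ level-b₀ eq a₀<a)
            ; after = after ; lowest = <⇒≤ a₀<a
            ; climb = λ y<a₀ e → climb y<a₀ (excursion-step e p (<-≤-trans y<a₀ lowest)) }
      where open LowestPart rest renaming (bad to bad₀)

  layered : (V → Fin (4 ^ k)) → V → Fin (4 ^ suc k)
  layered φ v = combine (word (level v)) (φ v)

  layered-level : ∀ φ {u v} → layered φ u ≡ layered φ v → word (level u) ≡ word (level v)
  layered-level φ {u} {v} = combine-injectiveˡ (word (level u)) (φ u) (word (level v)) (φ v)

  layered-within : ∀ φ {u v} → layered φ u ≡ layered φ v → φ u ≡ φ v
  layered-within φ {u} {v} = combine-injectiveʳ (word (level u)) (φ u) (word (level v)) (φ v)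

  -- The lowest part would be a violation in its layer: from its last vertex the walk climbs to `x`,
  -- crosses to `b` and comes down to `b₀`, so these two layer vertices are adjacent or equal.
  layered-noViolation : ∀ φ → NoViolation (LazyAdjacent layerBack) φ → NoViolation _~_ (layered φ)
  layered-noViolation φ nv {a} {b} {x} {y} bad@(_ , φ≡) walk x~b = nv P.bad P.inside
    (within-layer (trans (sym P.level-a₁) P.level-b₀)
      (excursion-join (trans (sym P.level-a₁) P.level-b₀) P.after x~b P.before-b))
    where
    levels≡ : level a ≡ level b
    levels≡ = word-walk-nonrepetitive (layered-level φ φ≡)
      (gmap (λ (u , v) → level u , level v)
            (λ (p , q , _ , eq) → level-near p , level-near q , layered-level φ eq) walk)
      (level-near x~b)
    lowestPart : ∀ {a b x y} → level a ≡ level b → Bad (layered φ) (a , b) →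
      Star (PairStep _~_ (layered φ)) (a , b) (x , y) → LowestPart φ a b x
    lowestPart eq (≢ , φ≡) ε = trivialPart φ eq (≢ , layered-within φ φ≡) here (λ _ e → e)
    lowestPart eq (≢ , φ≡) ((p , q , bad′@(_ , φ≡′)) ◅ w) =
      prepend φ eq (≢ , layered-within φ φ≡) p q (lowestPart eq′ bad′ w)
      where
      -- Both next levels are near the same level and carry the same letter.
      eq′ = near-determined (level-near p) (subst (λ l → Near l _) (sym eq) (level-near q))
              (layered-level φ φ≡′)
    module P = LowestPart (lowestPart levels≡ bad walk)

edgeless-noViolation : ∀ {V C : Set} (H : Chordal V 0) (φ : V → C) →
  NoViolation (LazyAdjacent (Chordal.back H)) φ
edgeless-noViolation {V} H φ (a≢b , _) walk x~b = a≢b (trans (fixed walk) (adjacent⇒≡ x~b))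
  where
  open Chordal H
  ∉back : ∀ {u v} → ¬ (u ∈ˡ back v)
  ∉back {v = v} u∈ with back v | back-bounded v
  ∉back () | [] | _
  ∉back _ | _ ∷ _ | ()
  adjacent⇒≡ : ∀ {u v} → LazyAdjacent back u v → u ≡ v
  adjacent⇒≡ (inj₁ eq)         = eq
  adjacent⇒≡ (inj₂ (inj₁ u∈)) = contradiction u∈ ∉back
  adjacent⇒≡ (inj₂ (inj₂ v∈)) = contradiction v∈ ∉back
  fixed : ∀ {a b x y} → Star (PairStep (LazyAdjacent back) φ) (a , b) (x , y) → a ≡ x
  fixed ε             = refl
  fixed ((p , _) ◅ w) = trans (adjacent⇒≡ p) (fixed w)

chordal-colourable : ∀ {V : Set} k (H : Chordal V k) →
  ∃ λ (φ : V → Fin (4 ^ k)) → NoViolation (LazyAdjacent (Chordal.back H)) φ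
chordal-colourable zero    H = (λ _ → zero) , edgeless-noViolation H _
chordal-colourable (suc k) H with chordal-colourable k (Layering.layer H)
... | φ , nv = Layering.layered H φ , Layering.layered-noViolation H φ nv

-- Chordal completion of a tree decomposition

module Elimination (T : SimpleGraph) (acyclic : ¬ Cycle T) where
  open SimpleGraph T hiding (order; Vertex)

  -- Isolated vertices of `S` count as leaves, so connectedness of `S` need not be maintained during
  -- removal.
  Leaf : Subset (order T) → Vertex T → Set
  Leaf S x = x ∈ S × (∀ {y z} → y ∈ S → z ∈ S → x ~ y → x ~ z → y ≡ z)

  record Path (l : ℕ) : Set where
    field
      vertices : Vector (Vertex T) l
      distinct : Injective _≡_ _≡_ vertices
      walk     : IsWalk _~_ vertices

  open Path

  singleton : Vertex T → Path 1
  singleton x = record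
    { vertices = λ _ → x ; distinct = λ { {zero} {zero} _ → refl } ; walk = λ { zero zero () } }

  cons : ∀ {l} z (p : Path (suc l)) → z ~ vertices p zero → (∀ j → vertices p j ≢ z) → Path (suc (suc l))
  cons z p a fresh = record
    { vertices = z ∷ᵛ vertices p
    ; distinct = λ
      { {zero}  {zero}  _  → refl
      ; {zero}  {suc j} eq → contradiction (sym eq) (fresh j)
      ; {suc i} {zero}  eq → contradiction eq (fresh i)
      ; {suc i} {suc j} eq → cong suc (distinct p eq) }
    ; walk = λ
      { zero    (suc zero) _ → a
      ; (suc i) (suc j)    e → walk p i j (suc-injective e) }
    }

  -- The chord closes the first `3 + toℕ j` vertices of the path into a cycle.
  no-chord : ∀ {l} (p : Path (2 + l)) j → ¬ (vertices p (suc (suc j)) ~ vertices p zero)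
  no-chord {l} p j chord = acyclic record
    { vertices = vertices p ∘ embed
    ; distinct = λ eq → inject≤-injective 3+j≤ 3+j≤ _ _ (distinct p eq)
    ; walk     = λ i i′ e → walk p _ _
        (trans (cong suc (toℕ-inject≤ i 3+j≤)) (trans e (sym (toℕ-inject≤ i′ 3+j≤))))
    ; closing  = subst (λ i → vertices p i ~ vertices p zero) (sym last) chord
    }
    where
    3+j≤ : 3 + toℕ j ≤ 2 + l
    3+j≤ = s≤s (s≤s (toℕ<n j))
    embed : Fin (3 + toℕ j) → Fin (2 + l)
    embed i = inject≤ i 3+j≤
    last : embed (fromℕ (2 + toℕ j)) ≡ suc (suc j)
    last = toℕ-injective (trans (toℕ-inject≤ _ 3+j≤) (toℕ-fromℕ (2 + toℕ j)))

  -- Extend the path at its head while possible. A further neighbour on the path would be a chord,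
  -- so a stuck head is a leaf. When `fuel` runs out the path would have more vertices than the
  -- tree.
  grow : ∀ fuel {l S} → order T ≤ fuel + l → (p : Path (2 + l)) → (∀ i → vertices p i ∈ S) → ∃ (Leaf S)
  grow zero short p _ = contradiction (≤-trans (injective⇒≤ (distinct p)) short) (<⇒≱ (m<n+m _ (s≤s z≤n)))
  grow (suc fuel) {l} {S} short p inS
    with any? (λ z → z ∈? S ×-dec (vertices p zero ~? z) ×-dec ¬? (z ≟ vertices p (suc zero)))
  ... | no none = vertices p zero , inS zero , λ y∈ z∈ a b → trans (only y∈ a) (sym (only z∈ b))
    where
    only : ∀ {y} → y ∈ S → vertices p zero ~ y → y ≡ vertices p (suc zero)
    only y∈ a = decidable-stable (_ ≟ _) λ y≢ → none (_ , y∈ , a , y≢)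
  ... | yes (z , z∈ , a , z≢) with any? (λ j → vertices p j ≟ z)
  ...   | no fresh = grow fuel (≤-trans short (≤-reflexive (sym (+-suc fuel l))))
            (cons z p (~-sym a) (λ j eq → fresh (j , eq))) λ { zero → z∈ ; (suc i) → inS i }
  ...   | yes (zero , refl)         = contradiction a (~-irrefl refl)
  ...   | yes (suc zero , refl)     = contradiction refl z≢
  ...   | yes (suc (suc j) , refl) = contradiction (~-sym a) (no-chord p j)

  leaf : ∀ {S x} → x ∈ S → ∃ (Leaf S)
  leaf {S} {x} x∈ with any? (λ z → z ∈? S ×-dec (x ~? z))
  ... | no none = x , x∈ , λ y∈ _ a _ → contradiction (_ , y∈ , a) none
  ... | yes (z , z∈ , a) = grow (order T) (m≤m+n _ 0)
          (cons z (singleton x) (~-sym a) λ _ x≡z → ~-irrefl x≡z a)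
          λ { zero → z∈ ; (suc zero) → x∈ }

  record Ranking (S : Subset (order T)) (bound : ℕ) : Set where
    field
      rank          : Vertex T → ℕ
      rank<bound    : ∀ {x} → x ∈ S → rank x < bound
      rank-distinct : ∀ {x y} → x ∈ S → y ∈ S → x ~ y → rank x ≢ rank y
      lower-unique  : ∀ {x y z} → x ∈ S → y ∈ S → z ∈ S → x ~ y → x ~ z →
                      rank y < rank x → rank z < rank x → y ≡ z

  -- The removed leaf gets the top value `n`, so its neighbours in `S` rank lower, and there is at
  -- most one of them.
  ranking : ∀ n S → ∣ S ∣ ≤ n → Ranking S n
  ranking n S ∣S∣≤n with nonempty? S
  ... | no empty = record
        { rank = λ _ → 0
        ; rank<bound = λ x∈ → contradiction (_ , x∈) empty
        ; rank-distinct = λ x∈ → contradiction (_ , x∈) empty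
        ; lower-unique = λ x∈ → contradiction (_ , x∈) empty }
  ranking zero S ∣S∣≤0 | yes (x , x∈) = contradiction (≤-trans (x∈p⇒∣p-x∣<∣p∣ x∈) ∣S∣≤0) λ ()
  ranking (suc n) S ∣S∣≤n | yes (_ , x∈) with leaf x∈
  ... | l , l∈ , l-leaf = record
        { rank = rank′ ; rank<bound = bound ; rank-distinct = apart ; lower-unique = unique }
    where
    open Ranking (ranking n (S - l) (s≤s⁻¹ (≤-trans (x∈p⇒∣p-x∣<∣p∣ l∈) ∣S∣≤n)))
    rank′ : Vertex T → ℕ
    rank′ x with x ≟ l
    ... | yes _ = n
    ... | no  _ = rank x
    rest : ∀ {x} → x ∈ S → x ≢ l → x ∈ S - l
    rest = x∈p∧x≢y⇒x∈p-y
    bound : ∀ {x} → x ∈ S → rank′ x < suc n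
    bound {x} x∈ with x ≟ l
    ... | yes _  = ≤-refl
    ... | no x≢l = m<n⇒m<1+n (rank<bound (rest x∈ x≢l))
    apart : ∀ {x y} → x ∈ S → y ∈ S → x ~ y → rank′ x ≢ rank′ y
    apart {x} {y} x∈ y∈ a with x ≟ l | y ≟ l
    ... | yes refl | yes refl = contradiction a (~-irrefl refl)
    ... | yes _    | no y≢l   = >⇒≢ (rank<bound (rest y∈ y≢l))
    ... | no x≢l   | yes _    = <⇒≢ (rank<bound (rest x∈ x≢l))
    ... | no x≢l   | no y≢l   = rank-distinct (rest x∈ x≢l) (rest y∈ y≢l) a
    unique : ∀ {x y z} → x ∈ S → y ∈ S → z ∈ S → x ~ y → x ~ z →
             rank′ y < rank′ x → rank′ z < rank′ x → y ≡ z
    unique {x} {y} {z} x∈ y∈ z∈ a b y<x z<x with x ≟ l | y ≟ l | z ≟ l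
    ... | yes refl | _      | _      = l-leaf y∈ z∈ a b
    ... | no x≢l | yes _    | _      = contradiction (rank<bound (rest x∈ x≢l)) (<-asym y<x)
    ... | no x≢l | no _     | yes _  = contradiction (rank<bound (rest x∈ x≢l)) (<-asym z<x)
    ... | no x≢l | no y≢l   | no z≢l = lower-unique (rest x∈ x≢l) (rest y∈ y≢l) (rest z∈ z≢l) a b y<x z<x

  open Ranking (ranking (order T) ⊤ (≤-reflexive (∣⊤∣≡n (order T)))) public
    using (rank)
  open Ranking (ranking (order T) ⊤ (≤-reflexive (∣⊤∣≡n (order T))))
    using (rank-distinct; lower-unique)

  Descending : (Vertex T → Set) → Vertex T → Vertex T → Set
  Descending P x y = P y × x ~ y × rank y < rank x

  -- Walks inside P to a vertex of minimum rank can be cut at local maxima.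
  descend : ∀ {P : Vertex T → Set} {x t} → P t → (∀ {y} → P y → rank t ≤ rank y) →
    Star (λ u v → P u × P v × u ~ v) x t → Star (Descending P) x t
  descend pt least ε = ε
  descend {P} {x} {t} pt least (_◅_ {j = y} (px , py , a) w) with <-cmp (rank y) (rank x)
  ... | tri< y<x _ _ = (py , a , y<x) ◅ descend pt least w
  ... | tri≈ _ eq _  = contradiction (sym eq) (rank-distinct ∈⊤ ∈⊤ a)
  ... | tri> _ _ x<y with descend pt least w
  ...   | ε = contradiction (least px) (<⇒≱ x<y)
  ...   | (_ , b , z<y) ◅ d with lower-unique ∈⊤ ∈⊤ ∈⊤ b (~-sym a) z<y x<y
  ...     | refl = d

  descending-≤ : ∀ {P : Vertex T → Set} {x t} → Star (Descending P) x t → rank t ≤ rank x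
  descending-≤ ε                  = ≤-refl
  descending-≤ ((_ , _ , y<x) ◅ d) = ≤-trans (descending-≤ d) (<⇒≤ y<x)

  -- Lower neighbours are unique, so one descent from `x` is a prefix of the other; the one ending
  -- at the higher rank is the shorter.
  descents-nested : ∀ {P Q : Vertex T → Set} {x s t} → P x → rank s ≤ rank t →
    Star (Descending P) x s → Star (Descending Q) x t → P t
  descents-nested px s≤t _ ε = px
  descents-nested px s≤t ε ((_ , _ , y<x) ◅ d) =
    contradiction (≤-trans s≤t (descending-≤ d)) (<⇒≱ y<x)
  descents-nested px s≤t ((py , a , y<x) ◅ c) ((_ , b , z<x) ◅ d)
    with lower-unique ∈⊤ ∈⊤ ∈⊤ a b y<x z<x
  ... | refl = descents-nested py s≤t c d

unique-in-subset : ∀ {n} {xs : List (Fin n)} {p : Subset n} → Unique xs → All (_∈ p) xs → length xs ≤ ∣ p ∣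
unique-in-subset [] [] = z≤n
unique-in-subset (x∉ ∷ u) (x∈ ∷ all) = ≤-trans
  (s≤s (unique-in-subset u (All.map (λ (≢ , y∈) → x∈p∧x≢y⇒x∈p-y y∈ (≢ ∘ sym)) (All.zip (x∉ , all)))))
  (x∈p⇒∣p-x∣<∣p∣ x∈)

digits-≤ : ∀ {n i j} a b → j < n → i + a * n ≤ j + b * n → a ≤ b
digits-≤ {n} {i} {j} a b j<n le = ≮⇒≥ λ b<a → <-irrefl refl (begin-strict
  i + a * n  ≤⟨ le ⟩
  j + b * n  <⟨ +-monoˡ-< (b * n) j<n ⟩
  suc b * n  ≤⟨ *-monoˡ-≤ n b<a ⟩
  a * n      ≤⟨ m≤n+m (a * n) i ⟩
  i + a * n  ∎)
  where open ≤-Reasoning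

-- Ordering the vertices of the graph by their topmost nodes

module Completion (G : SimpleGraph) (D : TreeDecomposition G) where
  open SimpleGraph G using (_~_)
  open TreeDecomposition D
  open Elimination tree (IsTree.acyclic isTree)

  nodes : Vertex G → List (Vertex tree)
  nodes v = filter (λ x → v ∈? bag x) (allFin _)

  -- The root of the subtree of nodes whose bags contain `v`. The default of `argmin` is itself such
  -- a node.
  top : Vertex G → Vertex tree
  top v = argmin rank (proj₁ (vertexCovered v)) (nodes v)

  top-∈ : ∀ v → v ∈ bag (top v)
  top-∈ v = argmin-all rank (proj₂ (vertexCovered v)) (all-filter (λ x → v ∈? bag x) (allFin _))

  top-least : ∀ {v x} → v ∈ bag x → rank (top v) ≤ rank x
  top-least {v} v∈ = All.lookup (f[argmin]≤f[xs] (proj₁ (vertexCovered v)) (nodes v))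
    (∈-filter⁺ (λ x → v ∈? bag x) (∈-allFin _) v∈)

  -- Descending from `x`, one reaches `top v` no later than `top u`, and all nodes up to `top u`
  -- contain `u`.
  top-nested : ∀ {u v x} → u ∈ bag x → v ∈ bag x → rank (top u) ≤ rank (top v) → u ∈ bag (top v)
  top-nested u∈ v∈ u≤v = descents-nested u∈ u≤v (to-top u∈) (to-top v∈)
    where
    to-top : ∀ {v x} → v ∈ bag x → Star (Descending (λ y → v ∈ bag y)) x (top v)
    to-top {v} v∈ = descend (top-∈ v) top-least (bagsConnected v v∈ (top-∈ v))

  -- A lexicographic order in base `order G`: the rank of the top node first, ties broken by the
  -- vertex number.
  key : Vertex G → ℕ
  key v = toℕ v + rank (top v) * order G

  key-≤ : ∀ {u v} → key u ≤ key v → rank (top u) ≤ rank (top v)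
  key-≤ {u} {v} = digits-≤ {i = toℕ u} _ _ (toℕ<n v)

  key-injective : ∀ {u v} → key u ≡ key v → u ≡ v
  key-injective {u} {v} eq = toℕ-injective (+-cancelʳ-≡ (rank (top u) * order G) _ _
    (trans eq (cong (λ r → toℕ v + r * order G)
      (≤-antisym (key-≤ {v} {u} (≤-reflexive (sym eq))) (key-≤ {u} {v} (≤-reflexive eq))))))

  earlier? : ∀ v u → _
  earlier? v u = (u ∈? bag (top v)) ×-dec (key u <? key v)

  back : Vertex G → List (Vertex G)
  back v = filter (earlier? v) (allFin _)

  back⁺ : ∀ {u v} → u ∈ bag (top v) → key u < key v → u ∈ˡ back v
  back⁺ {v = v} u∈ u<v = ∈-filter⁺ (earlier? v) (∈-allFin _) (u∈ , u<v)

  back⁻ : ∀ {u v} → u ∈ˡ back v → u ∈ bag (top v) × key u < key v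
  back⁻ {v = v} u∈ = proj₂ (∈-filter⁻ (earlier? v) {xs = allFin _} u∈)

  common-bag⇒adjacent : ∀ {u v x} → u ∈ bag x → v ∈ bag x → LazyAdjacent back u v
  common-bag⇒adjacent {u} {v} u∈ v∈ with <-cmp (key u) (key v)
  ... | tri< u<v _ _ = inj₂ (inj₁ (back⁺ (top-nested u∈ v∈ (key-≤ {u} {v} (<⇒≤ u<v))) u<v))
  ... | tri≈ _ eq _  = inj₁ (key-injective eq)
  ... | tri> _ _ v<u = inj₂ (inj₂ (back⁺ (top-nested v∈ u∈ (key-≤ {v} {u} (<⇒≤ v<u))) v<u))

  completion : ∀ {k} → WidthAtMost k D → Chordal (Vertex G) k
  completion width = record
    { back         = back
    ; rank         = key
    ; back-<       = λ u∈ → proj₂ (back⁻ u∈)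
    ; back-clique  = λ u∈ w∈ → common-bag⇒adjacent (proj₁ (back⁻ u∈)) (proj₁ (back⁻ w∈))
    -- `v` itself takes one of the at most `suc k` places in the bag of `top v`.
    ; back-bounded = λ v → s≤s⁻¹ (≤-trans
        (unique-in-subset
          (All.tabulate (λ u∈ v≡u → <⇒≢ (proj₂ (back⁻ u∈)) (cong key (sym v≡u)))
            ∷ filter⁺ (earlier? v) (allFin⁺ _))
          (top-∈ v ∷ All.tabulate (proj₁ ∘ back⁻)))
        (width (top v)))
    }

  lazyStep⇒adjacent : ∀ {u v} → LazyStep G u v → LazyAdjacent back u v
  lazyStep⇒adjacent (inj₁ a)  = let _ , u∈ , v∈ = edgeCovered a in common-bag⇒adjacent u∈ v∈
  lazyStep⇒adjacent (inj₂ eq) = inj₁ eq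

-- From pair walks back to lazy walks, and the bound

walk⇒star : {A : Set} {R : Rel A _} → ∀ m (f : Vector A (suc m)) →
  IsWalk R f → Star R (f zero) (f (fromℕ m))
walk⇒star zero    f w = ε
walk⇒star (suc m) f w =
  w zero (suc zero) refl ◅ walk⇒star m (f ∘ suc) λ i j e → w (suc i) (suc j) (cong suc e)

noViolation⇒stronglyNonrepetitive : ∀ G {C : Set} {_~_ : Vertex G → Vertex G → Set} {φ : Vertex G → C} →
  (∀ {u v} → LazyStep G u v → u ~ v) → NoViolation _~_ φ → StronglyNonrepetitive G φ
noViolation⇒stronglyNonrepetitive G {_~_ = _~_} {φ} embed nv (suc s) v w rep
  with any? (λ i → v (i ↑ˡ suc s) ≟ v (suc s ↑ʳ i))
... | yes found = found
... | no  none  = contradiction joint (nv (bad zero) (walk⇒star s pairs pairs-walk))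
  where
  pairs : Vector (Vertex G × Vertex G) (suc s)
  pairs i = v (i ↑ˡ suc s) , v (suc s ↑ʳ i)
  bad : ∀ i → Bad φ (pairs i)
  bad i = (λ eq → none (i , eq)) , rep i
  pairs-walk : IsWalk (PairStep _~_ φ) pairs
  pairs-walk i j e =
      embed (w _ _ (trans (cong suc (toℕ-↑ˡ i (suc s))) (trans e (sym (toℕ-↑ˡ j (suc s))))))
    , embed (w _ _ (trans (cong suc (toℕ-↑ʳ (suc s) i)) (trans (sym (+-suc (suc s) (toℕ i)))
        (trans (cong (suc s +_) e) (sym (toℕ-↑ʳ (suc s) j))))))
    , bad j
  -- Counting from 0, position `s` ends the first half and position `suc s` begins the second.
  joint = embed (w (fromℕ s ↑ˡ suc s) (suc s ↑ʳ zero)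
    (trans (cong suc (trans (toℕ-↑ˡ (fromℕ s) (suc s)) (toℕ-fromℕ s)))
           (sym (trans (toℕ-↑ʳ (suc s) (zero {s})) (+-identityʳ (suc s))))))

mainTheorem5 : (k : ℕ) (G : SimpleGraph) → TreewidthAtMost k G → π* G ≤ 4 ^ k
mainTheorem5 k G (D , width) =
  let φ , nv = chordal-colourable k (completion width)
  in proj₂ (π*-isMinimum G) (4 ^ k)
       (φ , noViolation⇒stronglyNonrepetitive G lazyStep⇒adjacent nv)
  where open Completion G D
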